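{- $\mathsf{LC}$ is $\mathsf{TNNIL}$-conservative over $\mathsf{LLe}^+$: for every $A\in\mathsf{TNNIL}$, if $\mathsf{LC}\vdash A$ then $\mathsf{LLe}^+\vdash A$.
   Context: Modal language: propositional variables, $\bot$, $\wedge,\vee,\to$, $\Box$; atomic = variables and $\bot$; $\boxdot A:=A\wedge\Box A$. $\mathsf{iK4}$: intuitionistic propositional logic in the modal language plus $\Box(A\to B)\to(\Box A\to\Box B)$ and $\Box A\to\Box\Box A$, closed under modus ponens and necessitation; $\mathsf{iGL}$: $\mathsf{iK4}$ plus Löb's axiom $\Box(\Box A\to A)\to\Box A$. $\mathsf{LC}:=\mathsf{iGL}+\{A\to\Box A\}$ (completeness principle for all $A$). $\mathsf{NOI}$: propositions in which every $\to$ lies in the scope of a $\Box$. Leivant's translation: $A^l=A$ for atomic/boxed $A$; $(A\wedge B)^l=A^l\wedge B^l$; $(A\vee B)^l=\boxdot A^l\vee\boxdot B^l$; $(A\to B)^l=A\to B^l$ if $A\in\mathsf{NOI}$, else $A\to B$. $\mathsf{LLe}^+:=\mathsf{iGL}+\{\Box A\to\Box A^l\}+\{p\to\Box p: p\text{ atomic}\}$. $\mathsf{TNNIL}$: smallest class containing atomic propositions, closed under $\wedge,\vee,\Box$, and containing $A\to B$ whenever $A,B\in\mathsf{TNNIL}$ and $A\in\mathsf{NOI}$. -}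

module Defs where

open import Data.Nat.Base using (ℕ)
open import Data.Product.Base using (_,_)
open import Level using (0ℓ)
open import Relation.Nullary.Decidable.Core using (yes; no; map′; _×-dec_)
open import Relation.Unary using (Pred; Decidable; ∅; _∪_)

infixr 7 _∧_
infixr 6 _∨_
infixr 5 _⇒_
infix  8 □_ ⊡_

data Formula : Set where
  var : ℕ → Formula
  ⊥′  : Formula
  _∧_ : Formula → Formula → Formula
  _∨_ : Formula → Formula → Formula
  _⇒_ : Formula → Formula → Formula
  □_  : Formula → Formula

⊡_ : Formula → Formula
⊡ A = A ∧ □ A

data Atomic : Pred Formula 0ℓ where
  var : ∀ n → Atomic (var n)
  ⊥′  : Atomic ⊥′

-- Every implication lies in the scope of a box: no implication is
-- reachable through ∧ and ∨ alone, and nothing is required below a box.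
data NOI : Pred Formula 0ℓ where
  atom : ∀ {A} → Atomic A → NOI A
  _∧_  : ∀ {A B} → NOI A → NOI B → NOI (A ∧ B)
  _∨_  : ∀ {A B} → NOI A → NOI B → NOI (A ∨ B)
  □_   : ∀ A → NOI (□ A)

NOI? : Decidable NOI
NOI? (var n) = yes (atom (var n))
NOI? ⊥′      = yes (atom ⊥′)
NOI? (A ∧ B) = map′ (λ { (a , b) → a ∧ b }) (λ { (a ∧ b) → a , b }) (NOI? A ×-dec NOI? B)
NOI? (A ∨ B) = map′ (λ { (a , b) → a ∨ b }) (λ { (a ∨ b) → a , b }) (NOI? A ×-dec NOI? B)
NOI? (A ⇒ B) = no λ { (atom ()) }
NOI? (□ A)   = yes (□ A)

data TNNIL : Pred Formula 0ℓ where
  atom : ∀ {A} → Atomic A → TNNIL A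
  _∧_  : ∀ {A B} → TNNIL A → TNNIL B → TNNIL (A ∧ B)
  _∨_  : ∀ {A B} → TNNIL A → TNNIL B → TNNIL (A ∨ B)
  □_   : ∀ {A} → TNNIL A → TNNIL (□ A)
  imp  : ∀ {A B} → TNNIL A → TNNIL B → NOI A → TNNIL (A ⇒ B)

infix 9 _ˡ

_ˡ : Formula → Formula
var n   ˡ = var n
⊥′      ˡ = ⊥′
(A ∧ B) ˡ = A ˡ ∧ B ˡ
(A ∨ B) ˡ = ⊡ (A ˡ) ∨ ⊡ (B ˡ)
(A ⇒ B) ˡ with NOI? A
... | yes _ = A ⇒ B ˡ
... | no  _ = A ⇒ B
(□ A)   ˡ = □ A

infix 3 _⊢_

-- A logic is given by the axioms it adds to iK4. The added axioms are subject
-- to both rules, so `L ⊢ A` has no undischarged assumptions.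
data _⊢_ (L : Pred Formula 0ℓ) : Pred Formula 0ℓ where
  ax  : ∀ {A} → L A → L ⊢ A
  K   : ∀ {A B} → L ⊢ A ⇒ B ⇒ A
  S   : ∀ {A B C} → L ⊢ (A ⇒ B ⇒ C) ⇒ (A ⇒ B) ⇒ A ⇒ C
  ∧I  : ∀ {A B} → L ⊢ A ⇒ B ⇒ A ∧ B
  ∧E₁ : ∀ {A B} → L ⊢ A ∧ B ⇒ A
  ∧E₂ : ∀ {A B} → L ⊢ A ∧ B ⇒ B
  ∨I₁ : ∀ {A B} → L ⊢ A ⇒ A ∨ B
  ∨I₂ : ∀ {A B} → L ⊢ B ⇒ A ∨ B
  ∨E  : ∀ {A B C} → L ⊢ (A ⇒ C) ⇒ (B ⇒ C) ⇒ A ∨ B ⇒ C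
  ⊥E  : ∀ {A} → L ⊢ ⊥′ ⇒ A
  □K  : ∀ {A B} → L ⊢ □ (A ⇒ B) ⇒ □ A ⇒ □ B
  □4  : ∀ {A} → L ⊢ □ A ⇒ □ □ A
  mp  : ∀ {A B} → L ⊢ A ⇒ B → L ⊢ A → L ⊢ B
  nec : ∀ {A} → L ⊢ A → L ⊢ □ A

data Löb : Pred Formula 0ℓ where
  löb : ∀ A → Löb (□ (□ A ⇒ A) ⇒ □ A)

data Completeness : Pred Formula 0ℓ where
  cp : ∀ A → Completeness (A ⇒ □ A)

data AtomicCompleteness : Pred Formula 0ℓ where
  cpₐ : ∀ {A} → Atomic A → AtomicCompleteness (A ⇒ □ A)

data Leivant : Pred Formula 0ℓ where
  le : ∀ A → Leivant (□ A ⇒ □ (A ˡ))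

iK4 iGL LC LLe⁺ : Pred Formula 0ℓ
iK4  = ∅
iGL  = iK4 ∪ Löb
LC   = iGL ∪ Completeness
LLe⁺ = iGL ∪ Leivant ∪ AtomicCompleteness

{-# OPTIONS --safe #-}

-- Build a Beth-style model of LC whose worlds are lists Γ of formulas read in
-- LLe⁺ as the hypotheses ⊡ (A ˡ) for A in Γ. TNNIL formulas can be reflected
-- into the model from ⊡ (A ˡ) and reified out of it as A: Leivant's translation
-- keeps both disjuncts boxed when a hypothesis is split, and since the
-- antecedents of TNNIL implications are NOI, adding such an antecedent A to Γ
-- costs nothing, as LLe⁺ ⊢ A ⇒ ⊡ (A ˡ). Löb's axiom holds in the model because
-- every step of the modal relation uses up one of finitely many boxed
-- subformulas; on the proof-theoretic side, reifying □ D uses Löb's axiom to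
-- assume □ D.
module Submission where

open import Defs
open import Data.List.Base using (List; []; _∷_; _++_; map; length; concatMap)
open import Data.List.Membership.Propositional using (_∈_; lose)
open import Data.List.Membership.Propositional.Properties
  using (∈-++⁺ˡ; ∈-++⁺ʳ; ∈-++⁻; ∈-map⁺; ∈-map⁻; ∈-concatMap⁺)
open import Data.List.Relation.Binary.Subset.Propositional using (_⊆_)
open import Data.List.Relation.Binary.Subset.Propositional.Properties using (map⁺)
open import Data.List.Relation.Unary.Any using (here; there)
open import Data.Nat.Base using (ℕ; suc; _≤_; _<_)
open import Data.Nat.Induction using (Acc; acc; <-wellFounded)
open import Data.Nat.Properties using (≤-refl; ≤-trans; ≤-reflexive; <⇒≤; <-≤-trans)
open import Data.Product.Base using (_×_; _,_; proj₁; proj₂; ∃-syntax)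
open import Data.Sum.Base using (_⊎_; inj₁; inj₂; [_,_]′; map₁)
open import Function.Base using (_∘_; id)
open import Level using (0ℓ)
open import Relation.Binary.PropositionalEquality using (_≡_; refl; sym; cong)
open import Relation.Nullary using (yes; no; contradiction)
open import Relation.Unary using (Pred)

private variable
  A B C D : Formula
  Γ Δ : List Formula

-- Local derivations and the deduction theorem

module Local (L : Pred Formula 0ℓ) where

  infix 3 _⊩_

  -- Derivations from hypotheses, which necessitation may not use.
  data _⊩_ (Γ : List Formula) : Formula → Set where
    hyp : A ∈ Γ → Γ ⊩ A
    thm : L ⊢ A → Γ ⊩ A
    mp  : Γ ⊩ A ⇒ B → Γ ⊩ A → Γ ⊩ B

  close : [] ⊩ A → L ⊢ A
  close (thm d)  = d
  close (mp d e) = mp (close d) (close e)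

  deduce : A ∷ Γ ⊩ B → Γ ⊩ A ⇒ B
  deduce (hyp (here refl)) = thm (mp (mp S K) (K {B = ⊥′}))
  deduce (hyp (there i))   = mp (thm K) (hyp i)
  deduce (thm d)           = thm (mp K d)
  deduce (mp d e)          = mp (mp (thm S) (deduce d)) (deduce e)

  cut : (∀ {A} → A ∈ Γ → Δ ⊩ A) → Γ ⊩ B → Δ ⊩ B
  cut σ (hyp i)  = σ i
  cut σ (thm d)  = thm d
  cut σ (mp d e) = mp (cut σ d) (cut σ e)

  weaken : Γ ⊆ Δ → Γ ⊩ A → Δ ⊩ A
  weaken i = cut (hyp ∘ i)

  box : (∀ {A} → A ∈ Γ → Δ ⊩ □ A) → Γ ⊩ B → Δ ⊩ □ B
  box σ (hyp i)  = σ i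
  box σ (thm d)  = thm (nec d)
  box σ (mp d e) = mp (mp (thm □K) (box σ d)) (box σ e)

  pair : Γ ⊩ A → Γ ⊩ B → Γ ⊩ A ∧ B
  pair d e = mp (mp (thm ∧I) d) e

  fst : Γ ⊩ A ∧ B → Γ ⊩ A
  fst = mp (thm ∧E₁)

  snd : Γ ⊩ A ∧ B → Γ ⊩ B
  snd = mp (thm ∧E₂)

  cases : Γ ⊩ A ∨ B → A ∷ Γ ⊩ C → B ∷ Γ ⊩ C → Γ ⊩ C
  cases d e f = mp (mp (mp (thm ∨E) (deduce e)) (deduce f)) d

  □⇒□⊡ : Γ ⊩ □ A → Γ ⊩ □ ⊡ A
  □⇒□⊡ d = mp (mp (thm □K) (mp (mp (thm □K) (thm (nec ∧I))) d)) (mp (thm □4) d)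

  hyp₀ : A ∷ Γ ⊩ A
  hyp₀ = hyp (here refl)

  hyp₁ : A ∷ B ∷ Γ ⊩ B
  hyp₁ = hyp (there (here refl))

  -- Hypotheses of the form `⊡ C` yield their own boxes by `□4`, so necessitation is sound under
  -- them.
  ⊡-nec : map ⊡_ Γ ⊩ A → map ⊡_ Γ ⊩ ⊡ A
  ⊡-nec d = pair d (box boxed d)
    where
    boxed : ∀ {A} → A ∈ map ⊡_ Γ → map ⊡_ Γ ⊩ □ A
    boxed i with ∈-map⁻ ⊡_ i
    ... | _ , _ , refl = □⇒□⊡ (snd (hyp i))

  ⊡-cut₁ : ⊡ A ∷ [] ⊩ B → Γ ⊩ ⊡ A → Γ ⊩ ⊡ B
  ⊡-cut₁ {A} d e = cut (λ { (here refl) → e }) (⊡-nec {A ∷ []} d)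

  ⊡-cut₂ : ⊡ A ∷ ⊡ B ∷ [] ⊩ C → Γ ⊩ ⊡ A → Γ ⊩ ⊡ B → Γ ⊩ ⊡ C
  ⊡-cut₂ {A} {B} d e f =
    cut (λ { (here refl) → e ; (there (here refl)) → f }) (⊡-nec {A ∷ B ∷ []} d)

open Local LLe⁺

-- Leivant's translation on `NOI` formulas

⇒-ˡ : NOI A → (A ⇒ B) ˡ ≡ A ⇒ B ˡ
⇒-ˡ {A} a with NOI? A
... | yes _ = refl
... | no ¬a = contradiction a ¬a

ˡ⇒ : NOI A → LLe⁺ ⊢ A ˡ ⇒ A
ˡ⇒ (atom (var n)) = close (deduce hyp₀)
ˡ⇒ (atom ⊥′)      = close (deduce hyp₀)
ˡ⇒ (□ A)          = close (deduce hyp₀)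
ˡ⇒ (a ∧ b) = close (deduce (pair (mp (thm (ˡ⇒ a)) (fst hyp₀)) (mp (thm (ˡ⇒ b)) (snd hyp₀))))
ˡ⇒ (a ∨ b) = close (deduce (cases hyp₀
  (mp (thm ∨I₁) (mp (thm (ˡ⇒ a)) (fst hyp₀)))
  (mp (thm ∨I₂) (mp (thm (ˡ⇒ b)) (fst hyp₀)))))

-- Completeness for `NOI` formulas reduces to atoms, boxes being covered by `□4`; the boxed
-- disjuncts that the translation asks for come from the induction hypothesis.
NOI⇒⊡ˡ : NOI A → LLe⁺ ⊢ A ⇒ ⊡ (A ˡ)
NOI⇒⊡ˡ (atom (var n)) = close (deduce
  (pair hyp₀ (mp (thm (ax (inj₂ (inj₂ (cpₐ (var n)))))) hyp₀)))
NOI⇒⊡ˡ (atom ⊥′) = ⊥E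
NOI⇒⊡ˡ (□ A) = close (deduce (pair hyp₀ (mp (thm □4) hyp₀)))
NOI⇒⊡ˡ (a ∧ b) = close (deduce (⊡-cut₂ (pair (fst hyp₀) (fst hyp₁))
  (mp (thm (NOI⇒⊡ˡ a)) (fst hyp₀)) (mp (thm (NOI⇒⊡ˡ b)) (snd hyp₀))))
NOI⇒⊡ˡ (a ∨ b) = close (deduce (cases hyp₀
  (⊡-cut₁ (mp (thm ∨I₁) hyp₀) (mp (thm (NOI⇒⊡ˡ a)) hyp₀))
  (⊡-cut₁ (mp (thm ∨I₂) hyp₀) (mp (thm (NOI⇒⊡ˡ b)) hyp₀))))

-- Translated contexts and Löb's rule

ctx : List Formula → List Formula
ctx Γ = map ⊡_ (map _ˡ Γ)

infix 3 _⊩ˡ_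

_⊩ˡ_ : List Formula → Formula → Set
Γ ⊩ˡ A = ctx Γ ⊩ A

ctx⁺ : Γ ⊆ Δ → ctx Γ ⊆ ctx Δ
ctx⁺ = map⁺ ⊡_ ∘ map⁺ _ˡ

hypˡ : A ∈ Γ → Γ ⊩ˡ ⊡ (A ˡ)
hypˡ i = hyp (∈-map⁺ ⊡_ (∈-map⁺ _ˡ i))

cut₁ : Γ ⊩ˡ ⊡ (A ˡ) → A ∷ Γ ⊩ˡ B → Γ ⊩ˡ B
cut₁ d e = mp (deduce e) d

unbox : Formula → List Formula
unbox (□ A) = A ∷ []
unbox _     = []

∈-unboxes⁺ : □ A ∈ Γ → A ∈ concatMap unbox Γ
∈-unboxes⁺ i = ∈-concatMap⁺ unbox (lose i (here refl))

∈-unboxes⁻ : A ∈ concatMap unbox Γ → □ A ∈ Γ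
∈-unboxes⁻ {Γ = B ∷ Γ} i with ∈-++⁻ (unbox B) i
∈-unboxes⁻ {Γ = □ B ∷ Γ} i | inj₁ (here refl) = here refl
...                        | inj₂ j           = there (∈-unboxes⁻ j)

-- Löb's axiom discharges `□ D`. The other hypotheses survive under the box: a member of `Γ` carries
-- its own box, and for `□ C` in `Γ` Leivant's axiom gives `□ (C ˡ)`.
löb-rule : □ D ∷ Γ ++ concatMap unbox Γ ⊩ˡ D → Γ ⊩ˡ □ D
löb-rule {D} {Γ} d =
  mp (thm (ax (inj₁ (inj₂ (löb D))))) (box boxed (deduce (cut σ d)))
  where
  Ψ = ctx (Γ ++ concatMap unbox Γ)

  σ : ∀ {A} → A ∈ ctx (□ D ∷ Γ ++ concatMap unbox Γ) → □ D ∷ Ψ ⊩ A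
  σ (here refl) = pair hyp₀ (mp (thm □4) hyp₀)
  σ (there i)   = hyp (there i)

  boxˡ : ∀ {A} → A ∈ Γ ++ concatMap unbox Γ → Γ ⊩ˡ □ (A ˡ)
  boxˡ i with ∈-++⁻ Γ i
  ... | inj₁ j = snd (hypˡ j)
  ... | inj₂ j = mp (thm (ax (inj₂ (inj₁ (le _))))) (fst (hypˡ (∈-unboxes⁻ j)))

  boxed : ∀ {A} → A ∈ Ψ → Γ ⊩ˡ □ A
  boxed i with ∈-map⁻ ⊡_ i
  ... | _ , j , refl with ∈-map⁻ _ˡ j
  ...   | _ , k , refl = □⇒□⊡ (boxˡ k)

-- Boxed subformulas, worlds and coverings

boxes : Formula → List Formula
boxes (var _) = []
boxes ⊥′      = []
boxes (A ∧ B) = boxes A ++ boxes B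
boxes (A ∨ B) = boxes A ++ boxes B
boxes (A ⇒ B) = boxes A ++ boxes B
boxes (□ A)   = A ∷ boxes A

remove : ∀ {U} → D ∈ U →
         ∃[ V ] length U ≡ suc (length V) × (∀ {E} → E ∈ U → E ∈ V ⊎ D ≡ E)
remove {U = _ ∷ V} (here refl) = V , refl , λ { (here refl) → inj₂ refl ; (there i) → inj₁ i }
remove {U = A ∷ _} (there i) with remove i
... | V , eq , f = A ∷ V , cong suc eq , λ { (here refl) → inj₁ (here refl) ; (there j) → map₁ there (f j) }

-- X lists the D for which reifying □ D must be possible.
module Model (X : List Formula) where

  -- The boxes that have not yet been assumed are in `pending`, whose length
  -- bounds the number of modal steps still possible.
  record World : Set where
    constructor world
    field
      hyps    : List Formula
      pending : List Formula
      assumed : ∀ {D} → D ∈ X → D ∈ pending ⊎ □ D ∈ hyps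

  open World

  private variable
    u v w : World
    P Q : World → Set

  size : World → ℕ
  size w = length (pending w)

  infix 4 _≼_ _⊏_

  record _≼_ (u v : World) : Set where
    constructor _,_
    field
      hyps⊆ : hyps u ⊆ hyps v
      size≤ : size v ≤ size u

  record _⊏_ (u v : World) : Set where
    constructor step
    field
      hyps⊆ : hyps u ⊆ hyps v
      opened : ∀ {C} → □ C ∈ hyps u → C ∈ hyps v
      size< : size v < size u

  ≼-refl : w ≼ w
  ≼-refl = id , ≤-refl

  ≼-trans : u ≼ v → v ≼ w → u ≼ w
  ≼-trans (i , m) (j , n) = j ∘ i , ≤-trans n m

  ⊏⇒≼ : u ⊏ v → u ≼ v
  ⊏⇒≼ (step i _ m) = i , <⇒≤ m

  ≼-⊏-trans : u ≼ v → v ⊏ w → u ⊏ w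
  ≼-⊏-trans (i , m) (step j k n) = step (j ∘ i) (k ∘ i) (<-≤-trans n m)

  extend : World → Formula → World
  extend w A = world (A ∷ hyps w) (pending w) (λ i → [ inj₁ , inj₂ ∘ there ]′ (assumed w i))

  ≼-extend : w ≼ extend w A
  ≼-extend = there , ≤-refl

  mono-⊩ : u ≼ v → hyps u ⊩ˡ A → hyps v ⊩ˡ A
  mono-⊩ (i , _) = weaken (ctx⁺ i)

  -- The covering modality in continuation-passing form: P holds after case
  -- distinctions, as far as derivability of conclusions C can tell.
  J : (World → Set) → World → Set
  J P w = ∀ {v} → w ≼ v → ∀ {C} → (∀ {u} → v ≼ u → P u → hyps u ⊩ˡ C) → hyps v ⊩ˡ C

  J-mono : u ≼ v → J P u → J P v
  J-mono i p j = p (≼-trans i j)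

  J-return : (∀ {v} → w ≼ v → P v) → J P w
  J-return p i k = k ≼-refl (p i)

  J-bind : J P w → (∀ {v} → w ≼ v → P v → J Q v) → J Q w
  J-bind p f i k = p i λ j x → f (≼-trans i j) x ≼-refl (k ∘ ≼-trans j)

  J-falsum : hyps w ⊩ˡ ⊥′ → J P w
  J-falsum d i _ = mp (thm ⊥E) (mono-⊩ i d)

  -- Semantics and soundness of LC

  ⟦_⟧ : Formula → World → Set
  ⟦ var n ⟧ w = hyps w ⊩ˡ var n
  ⟦ ⊥′ ⟧    w = hyps w ⊩ˡ ⊥′
  ⟦ A ∧ B ⟧ w = ⟦ A ⟧ w × ⟦ B ⟧ w
  ⟦ A ∨ B ⟧   = J λ v → ⟦ A ⟧ v ⊎ ⟦ B ⟧ v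
  ⟦ A ⇒ B ⟧ w = ∀ {v} → w ≼ v → ⟦ A ⟧ v → ⟦ B ⟧ v
  -- A derivable `□ A` need not be a member of `hyps`, and `opened` sees only members; under `J` it
  -- can be added.
  ⟦ □ A ⟧     = J λ v → ∀ u → v ⊏ u → ⟦ A ⟧ u

  mono : ∀ A → u ≼ v → ⟦ A ⟧ u → ⟦ A ⟧ v
  mono (var n) i x       = mono-⊩ i x
  mono ⊥′      i x       = mono-⊩ i x
  mono (A ∧ B) i (x , y) = mono A i x , mono B i y
  mono (A ∨ B) i x       = J-mono i x
  mono (A ⇒ B) i f j     = f (≼-trans i j)
  mono (□ A)   i x       = J-mono i x

  -- The sheaf condition, which lets a disjunction be eliminated into any formula. At atoms it holds
  -- because their meaning is itself derivability, the target of `J`.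
  paste : ∀ A → J ⟦ A ⟧ w → ⟦ A ⟧ w
  paste (var n) p     = p ≼-refl λ _ → id
  paste ⊥′      p     = p ≼-refl λ _ → id
  paste (A ∧ B) p     = paste A (J-bind p λ _ (x , _) → J-return λ i → mono A i x)
                      , paste B (J-bind p λ _ (_ , y) → J-return λ i → mono B i y)
  paste (A ∨ B) p     = J-bind p λ _ → id
  paste (A ⇒ B) p i x = paste B (J-bind (J-mono i p) λ j f →
                          J-return λ k → f k (mono A (≼-trans j k) x))
  paste (□ A)   p     = J-bind p λ _ → id

  falsum : ∀ A → ⟦ ⊥′ ⟧ w → ⟦ A ⟧ w
  falsum A d = paste A (J-falsum d)

  case : ∀ C → ⟦ A ∨ B ⟧ w → ⟦ A ⇒ C ⟧ w → ⟦ B ⇒ C ⟧ w → ⟦ C ⟧ w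
  case C p f g = paste C (J-bind p λ i →
    λ { (inj₁ x) → J-return λ j → mono C j (f i x)
      ; (inj₂ y) → J-return λ j → mono C j (g i y) })

  complete : ∀ A → ⟦ A ⟧ w → ⟦ □ A ⟧ w
  complete A x = J-return λ i _ j → mono A (≼-trans i (⊏⇒≼ j)) x

  distribute : ∀ {w} → ⟦ □ (A ⇒ B) ⟧ w → ⟦ □ A ⟧ w → ⟦ □ B ⟧ w
  distribute p q = J-bind p λ i f → J-bind (J-mono i q) λ j x →
    J-return λ k u l → f u (≼-⊏-trans (≼-trans j k) l) ≼-refl (x u (≼-⊏-trans k l))

  -- Well-founded induction on `size`, which each modal step lowers: the instances at the modal
  -- successors of a world form the `□ A` that `f` needs there.
  descend : ∀ A → (∀ {u} → w ⊏ u → ⟦ □ A ⇒ A ⟧ u) → w ⊏ v → ⟦ A ⟧ v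
  descend {w} {v} A f = go v (<-wellFounded _)
    where
    go : ∀ v → Acc _<_ (size v) → w ⊏ v → ⟦ A ⟧ v
    go v (acc r) i = f i ≼-refl (J-return λ j u k →
      let l = ≼-⊏-trans j k in go u (r (_⊏_.size< l)) (≼-⊏-trans (⊏⇒≼ i) l))

  sound : LC ⊢ A → ⟦ A ⟧ w
  sound (ax (inj₁ (inj₂ (löb A)))) _ p =
    J-bind p λ _ f → J-return λ i _ j → descend A (λ k → f _ (≼-⊏-trans i k)) j
  sound (ax (inj₂ (cp A))) _ = complete A
  sound (K {A}) _ x i _ = mono A i x
  sound S _ f i g j x = f (≼-trans i j) x ≼-refl (g j x)
  sound (∧I {A}) _ x i y = mono A i x , y
  sound ∧E₁ _ = proj₁
  sound ∧E₂ _ = proj₂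
  sound (∨I₁ {A}) _ x = J-return λ i → inj₁ (mono A i x)
  sound (∨I₂ {B = B}) _ y = J-return λ i → inj₂ (mono B i y)
  sound (∨E {A} {B} {C}) _ f i g j p =
    case {A = A} {B} C p (mono (A ⇒ C) (≼-trans i j) f) (mono (B ⇒ C) j g)
  sound (⊥E {A}) _ = falsum A
  sound (□K {A} {B}) _ p i q = distribute {A} {B} (J-mono i p) q
  sound (□4 {A}) _ = complete (□ A)
  sound (mp d e) = sound d ≼-refl (sound e)
  sound (nec {A} d) = complete A (sound d)

  -- Reflection and reification

  reflect : TNNIL A → boxes A ⊆ X → hyps w ⊩ˡ ⊡ (A ˡ) → ⟦ A ⟧ w
  reify   : TNNIL A → boxes A ⊆ X → ⟦ A ⟧ w → hyps w ⊩ˡ A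

  reflect (atom (var n)) _ d = fst d
  reflect (atom ⊥′)      _ d = fst d
  reflect (a ∧ b) s d =
    reflect a (s ∘ ∈-++⁺ˡ) (⊡-cut₁ (fst (fst hyp₀)) d) ,
    reflect b (s ∘ ∈-++⁺ʳ _) (⊡-cut₁ (snd (fst hyp₀)) d)
  reflect (_∨_ {A} {B} a b) s d i k =
    -- The translated disjuncts are `⊡ (A ˡ)` and `⊡ (B ˡ)`, exactly the hypotheses that `extend`
    -- adds.
    cases (fst (mono-⊩ i d)) (branch a (s ∘ ∈-++⁺ˡ) inj₁) (branch b (s ∘ ∈-++⁺ʳ _) inj₂)
    where
    branch : ∀ {D} → TNNIL D → boxes D ⊆ X → (∀ {u} → ⟦ D ⟧ u → ⟦ A ⟧ u ⊎ ⟦ B ⟧ u) → _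
    branch {D} t r inj = k (≼-extend {A = D}) (inj (reflect t r hyp₀))
  reflect (□_ {A} a) s d i k =
    cut₁ {A = □ A} (mono-⊩ i d) (k ≼-extend λ _ j →
      reflect a (s ∘ there) (hypˡ {A = A} (_⊏_.opened j (here refl))))
  reflect {w = w} (imp {A} {B} a b n) s d i x =
    reflect b (s ∘ ∈-++⁺ʳ (boxes A)) (⊡-cut₂ modus
      (mp (thm (NOI⇒⊡ˡ n)) (reify a (s ∘ ∈-++⁺ˡ) x)) (mono-⊩ i d))
    where
    modus : ⊡ (A ˡ) ∷ ⊡ ((A ⇒ B) ˡ) ∷ [] ⊩ B ˡ
    modus rewrite ⇒-ˡ {B = B} n = mp (fst hyp₁) (mp (thm (ˡ⇒ n)) (fst hyp₀))

  reify (atom (var n)) _ d = d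
  reify (atom ⊥′)      _ d = d
  reify (a ∧ b) s (x , y) = pair (reify a (s ∘ ∈-++⁺ˡ) x) (reify b (s ∘ ∈-++⁺ʳ _) y)
  reify (a ∨ b) s p = p ≼-refl λ _ →
    λ { (inj₁ x) → mp (thm ∨I₁) (reify a (s ∘ ∈-++⁺ˡ) x)
      ; (inj₂ y) → mp (thm ∨I₂) (reify b (s ∘ ∈-++⁺ʳ _) y) }
  reify (imp {A} a b n) s f =
    -- The inner derivation assumes `⊡ (A ˡ)`; as `A` is `NOI`, this follows from `A` itself.
    deduce (mp (weaken there (deduce (reify b (s ∘ ∈-++⁺ʳ (boxes A))
      (f (≼-extend {A = A}) (reflect a (s ∘ ∈-++⁺ˡ) hyp₀))))) (mp (thm (NOI⇒⊡ˡ n)) hyp₀))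
  reify (□_ {A} a) s p = p ≼-refl λ {u} _ x → case-assumed u x (assumed u (s (here refl)))
    where
    case-assumed : ∀ u → (∀ v → u ⊏ v → ⟦ A ⟧ v) → A ∈ pending u ⊎ □ A ∈ hyps u → hyps u ⊩ˡ □ A
    case-assumed u x (inj₂ i) = fst (hypˡ {A = □ A} i)
    case-assumed u x (inj₁ i) with remove i
    ... | V , eq , f = löb-rule (reify a (s ∘ there) (x next (step
            (there ∘ ∈-++⁺ˡ) (there ∘ ∈-++⁺ʳ (hyps u) ∘ ∈-unboxes⁺) (≤-reflexive (sym eq)))))
      where
      next : World
      -- One occurrence of `A` leaves `pending` as `□ A` enters `hyps`, along with the contents of
      -- the boxes in `hyps u`: a modal successor of `u` with the context that `löb-rule` expects.
      next = world (□ A ∷ hyps u ++ concatMap unbox (hyps u)) V λ j →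
        [ (λ k → [ inj₁ , (λ { refl → inj₂ (here refl) }) ]′ (f k))
        , inj₂ ∘ there ∘ ∈-++⁺ˡ ]′ (assumed u j)

theorem4p23 : ∀ (A : Formula) → TNNIL A → LC ⊢ A → LLe⁺ ⊢ A
-- At the root all boxed subformulas are pending and nothing is assumed, so the context is empty.
theorem4p23 A a d = close (reify a id (sound {w = root} d))
  where
  open Model (boxes A)

  root : World
  root = world [] (boxes A) inj₁
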